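{- For every partition $\lambda$ and all integers $k,l\ge 0$, $$HS_{\lambda}(X;Y)=\sum_{\alpha:\ \boldsymbol{\lambda}(\alpha)=\lambda}\mathcal{HQ}_{\alpha}(X;Y),$$ where the sum runs over all compositions $\alpha$ whose parts, sorted into weakly decreasing order, give $\lambda$.
   Context: Fix integers $k,l\ge 0$, let $\mathcal{A}=\{1,\dots,k\}$, $\mathcal{A}'=\{1',\dots,l'\}$, totally ordered by $1<2<\dots<k<1'<2'<\dots<l'$, and let $X=(x_1,\dots,x_k)$, $Y=(y_1,\dots,y_l)$. Diagrams use French notation: row $i$ is the $i$-th row from the bottom, and cell $(i,j)$ is in row $i$, column $j$ (from the left). A $(k,l)$-semistandard hook tableau (SSHT) of shape a partition $\lambda$ is a filling of the Young diagram of $\lambda$ (with $\lambda_i$ cells in row $i$) with letters from $\mathcal{A}\cup\mathcal{A}'$ such that all rows (left to right) and columns (bottom to top) weakly increase, unprimed entries weakly increase along rows and strictly increase up columns, and primed entries strictly increase along rows and weakly increase up columns. The hook Schur function is $HS_\lambda(X;Y)=\sum_T \prod_i x_i^{v_i}\prod_i y_i^{u_i}$ over all SSHT $T$ of shape $\lambda$, where $v_i$ (resp. $u_i$) is the number of entries $i$ (resp. $i'$) of $T$. For a composition $\alpha=(\alpha_1,\dots,\alpha_r)$ with largest part $m$, its diagram has $\alpha_i$ cells in row $i$. A hook composition tableau (HCT) of shape $\alpha$ is a filling $F$ of this diagram with letters of $\mathcal{A}\cup\mathcal{A}'$ such that: (1) entries weakly increase along each row from left to right; (2) the unprimed entries weakly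 increase and the primed entries strictly increase along each row from left to right; (3) in the leftmost column, the unprimed entries strictly increase and the primed entries weakly increase from bottom to top; (4) (triple rule) let $\hat F$ be $F$ extended to an $r\times m$ rectangle by putting $\infty$ (larger than every letter, and in neither $\mathcal{A}$ nor $\mathcal{A}'$) in each added cell; then for all $1\le i<j\le r$ and $1\le n<m$: (a) if $\hat F(i,n+1)\in\mathcal{A}$ and $\hat F(i,n+1)\ge \hat F(j,n)$ then $\hat F(i,n+1)>\hat F(j,n+1)$; (b) if $\hat F(i,n+1)\in\mathcal{A}'$ and $\hat F(i,n+1)>\hat F(j,n)$ then $\hat F(i,n+1)\ge\hat F(j,n+1)$. The quasisymmetric hook Schur function is $\mathcal{HQ}_\alpha(X;Y)=\sum_F\prod_i x_i^{v_i}\prod_i y_i^{u_i}$ over all HCT $F$ of shape $\alpha$, with $v_i,u_i$ the numbers of entries $i$, $i'$ in $F$.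
   Formalization: Condition (3) is strengthened: all entries of the leftmost column, primed and unprimed together, weakly increase from bottom to top; as printed the identity fails, e.g. for k = l = 1, λ = (2,1), where there are 2 SSHT but 4 HCT. -}

module Defs where

open import Data.Nat using (ℕ; zero; suc; _∸_; _⊔_; _<ᵇ_; _≤ᵇ_) renaming (_<_ to _<ℕ_)
open import Data.Nat.Properties using (≤-decTotalOrder)
open import Data.Fin using (Fin; toℕ)
open import Data.Fin.Properties using () renaming (_≟_ to _≟F_)
open import Data.Bool using (Bool; true; false; _∧_; _∨_; not; if_then_else_)
open import Data.Sum using (_⊎_; inj₁; inj₂)
open import Data.Sum.Properties using (≡-dec)
open import Data.Maybe using (Maybe; just; nothing)
open import Data.Product using (_×_; _,_)
open import Data.List using (List; []; _∷_; [_]; map; concatMap; mapMaybe; filterᵇ; upTo;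
                             allFin; length; concat; foldr; filter)
open import Data.Bool.ListAction using (all)
open import Data.Nat.ListAction using (sum)
open import Data.List.Relation.Unary.All using (All)
open import Data.List.Relation.Unary.Linked using (Linked)
import Data.List.Properties as LP
open import Data.Vec using (Vec; tabulate)
open import Relation.Nullary using (does)
open import Relation.Binary.PropositionalEquality using (_≡_)
open import Relation.Binary.Construct.Flip.EqAndOrd using (decTotalOrder)
import Data.List.Sort.InsertionSort.Base as Sort

-- Partitions and compositions (lists of parts, part i = row i from the bottom)

_≥ℕ_ : ℕ → ℕ → Set
m ≥ℕ n = n Data.Nat.≤ m

IsPartition : List ℕ → Set
IsPartition la = All (0 <ℕ_) la × Linked _≥ℕ_ la

sortDec : List ℕ → List ℕ
sortDec = Sort.sort (decTotalOrder ≤-decTotalOrder)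

-- all compositions (lists of positive integers) of n, enumerated with fuel f ≥ n
compsFuel : ℕ → ℕ → List (List ℕ)
compsFuel _       zero    = [ [] ]
compsFuel zero    (suc n) = []
compsFuel (suc f) (suc n) =
  concatMap (λ p → map (suc p ∷_) (compsFuel f (n ∸ p))) (upTo (suc n))

compositions : ℕ → List (List ℕ)
compositions n = compsFuel n n

compositionsOf : List ℕ → List (List ℕ)
compositionsOf la =
  filterᵇ (λ α → does (LP.≡-dec Data.Nat._≟_ (sortDec α) la)) (compositions (sum la))

-- Letters: inj₁ i is the unprimed letter i+1, inj₂ i is the primed letter (i+1)'

Letter : ℕ → ℕ → Set
Letter k l = Fin k ⊎ Fin l

module LetterOps (k l : ℕ) where

  _≤L_ : Letter k l → Letter k l → Bool
  inj₁ i ≤L inj₁ j = toℕ i ≤ᵇ toℕ j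
  inj₁ i ≤L inj₂ j = true
  inj₂ i ≤L inj₁ j = false
  inj₂ i ≤L inj₂ j = toℕ i ≤ᵇ toℕ j

  _<L_ : Letter k l → Letter k l → Bool
  inj₁ i <L inj₁ j = toℕ i <ᵇ toℕ j
  inj₁ i <L inj₂ j = true
  inj₂ i <L inj₁ j = false
  inj₂ i <L inj₂ j = toℕ i <ᵇ toℕ j

  unprimed : Letter k l → Bool
  unprimed (inj₁ _) = true
  unprimed (inj₂ _) = false

  primed : Letter k l → Bool
  primed a = not (unprimed a)

  _⇒ᵇ_ : Bool → Bool → Bool
  p ⇒ᵇ q = not p ∨ q

  bothU bothP : Letter k l → Letter k l → Bool
  bothU a b = unprimed a ∧ unprimed b
  bothP a b = primed a ∧ primed b

  -- extended letters: nothing = ∞, larger than every letter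
  _≤E_ : Maybe (Letter k l) → Maybe (Letter k l) → Bool
  just a  ≤E just b  = a ≤L b
  just _  ≤E nothing = true
  nothing ≤E just _  = false
  nothing ≤E nothing = true

  _<E_ : Maybe (Letter k l) → Maybe (Letter k l) → Bool
  just a  <E just b  = a <L b
  just _  <E nothing = true
  nothing <E _       = false

-- Fillings: a list of rows (row 1 = bottom row first), each row read left to right.
-- Indices below are 0-based: entry F i j is the paper's F(i+1, j+1).

Filling : ℕ → ℕ → Set
Filling k l = List (List (Letter k l))

nth : {A : Set} → List A → ℕ → Maybe A
nth []       _       = nothing
nth (x ∷ _)  zero    = just x
nth (_ ∷ xs) (suc n) = nth xs n

-- F̂(i,j): the entry, or ∞ (= nothing) for a cell outside the diagram
entry : {k l : ℕ} → Filling k l → ℕ → ℕ → Maybe (Letter k l)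
entry F i j with nth F i
... | nothing = nothing
... | just row = nth row j

pairwiseᵇ : {A : Set} → (A → A → Bool) → List A → Bool
pairwiseᵇ R []       = true
pairwiseᵇ R (a ∷ as) = all (R a) as ∧ pairwiseᵇ R as

column : {k l : ℕ} → Filling k l → ℕ → List (Letter k l)
column F j = mapMaybe (λ row → nth row j) F

maxPart : List ℕ → ℕ
maxPart = foldr _⊔_ 0

words : (k l : ℕ) → ℕ → List (List (Letter k l))
words k l zero    = [ [] ]
words k l (suc n) =
  concatMap (λ a → map (a ∷_) (words k l n)) (map inj₁ (allFin k) Data.List.++ map inj₂ (allFin l))

fillings : (k l : ℕ) → List ℕ → List (Filling k l)
fillings k l []      = [ [] ]
fillings k l (n ∷ s) = concatMap (λ w → map (w ∷_) (fillings k l s)) (words k l n)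

module _ {k l : ℕ} where
  open LetterOps k l

  rowOK : Letter k l → Letter k l → Bool
  rowOK a b = (a ≤L b) ∧ (bothU a b ⇒ᵇ (a ≤L b)) ∧ (bothP a b ⇒ᵇ (a <L b))

  colOK : Letter k l → Letter k l → Bool
  colOK a b = (a ≤L b) ∧ (bothU a b ⇒ᵇ (a <L b)) ∧ (bothP a b ⇒ᵇ (a ≤L b))

  firstColOK : Letter k l → Letter k l → Bool
  firstColOK a b = (a ≤L b) ∧ (bothU a b ⇒ᵇ (a <L b)) ∧ (bothP a b ⇒ᵇ (a ≤L b))

  isSSHT : Filling k l → Bool
  isSSHT F = all (pairwiseᵇ rowOK) F
           ∧ all (λ j → pairwiseᵇ colOK (column F j)) (upTo (maxPart (map length F)))

  tripleOK : Filling k l → ℕ → ℕ → ℕ → Bool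
  tripleOK F i j n with entry F i (suc n)
  ... | nothing = true
  ... | just (inj₁ a) = (entry F j n ≤E just (inj₁ a)) ⇒ᵇ (entry F j (suc n) <E just (inj₁ a))
  ... | just (inj₂ a) = (entry F j n <E just (inj₂ a)) ⇒ᵇ (entry F j (suc n) ≤E just (inj₂ a))

  isHCT : Filling k l → Bool
  isHCT F = all (pairwiseᵇ rowOK) F
          ∧ pairwiseᵇ firstColOK (column F 0)
          ∧ all (λ i → all (λ j → all (λ n → tripleOK F i j n)
                                      (upTo (maxPart (map length F) ∸ 1)))
                           (filterᵇ (i <ᵇ_) (upTo r)))
                (upTo r)
    where r = length F

-- Monomials and the two generating functions.
-- A polynomial with nonnegative integer coefficients is represented by the
-- multiset (list up to permutation) of its monomials; a monomial
-- ∏ x_i^{v_i} ∏ y_i^{u_i} is represented by its exponent vectors (v , u).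

Monomial : ℕ → ℕ → Set
Monomial k l = Vec ℕ k × Vec ℕ l

countLetter : {k l : ℕ} → Letter k l → Filling k l → ℕ
countLetter a F = length (filter (λ b → ≡-dec _≟F_ _≟F_ b a) (concat F))

weight : {k l : ℕ} → Filling k l → Monomial k l
weight F = tabulate (λ i → countLetter (inj₁ i) F) , tabulate (λ i → countLetter (inj₂ i) F)

HS : (k l : ℕ) → List ℕ → List (Monomial k l)
HS k l la = map weight (filterᵇ isSSHT (fillings k l la))

HQ : (k l : ℕ) → List ℕ → List (Monomial k l)
HQ k l α = map weight (filterᵇ isHCT (fillings k l α))

{-# OPTIONS --safe #-}
-- Call a ⊑ b the condition for b to stand to the right of a in a row, and a ◁ b := ¬ (b ⊑ a); the
-- latter is the condition for b to stand above a in a column, and the triple rule becomes: if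
-- F̂(j,n) ⊑ F̂(i,n+1) then F̂(j,n+1) ◁ F̂(i,n+1).  Sorting the columns of a composition tableau is
-- the bijection onto tableaux.  Adding a top row w to a composition tableau amounts to letting w
-- bubble up, column by column, through the rows of the sorted tableau.  By the triple rule, once
-- w falls below the row t it is passing it stays below it, so a comparison merely exchanges the
-- tails of t and w from some column on.  Conversely, w is recovered from the sorted tableau: walk
-- down from the top row, and move to the row s below at the first column n + 1 where the entry of
-- s can follow the n-th entry of w in a row.
module Submission where

open import Defs
open import Data.Bool using (Bool; true; false; T; _∧_; _∨_; not)
open import Data.Bool.ListAction using (all)
open import Data.Bool.Properties using (T?; T-∧)
open import Data.Empty using (⊥; ⊥-elim)
open import Data.Fin using (toℕ)
open import Data.Fin.Properties using () renaming (_≟_ to _≟F_)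
open import Data.List using (List; []; _∷_; _++_; map; concatMap; concat; filterᵇ; foldr; upTo;
                             allFin; length; mapMaybe; reverse)
import Data.List.Properties as List
open import Data.List.Membership.Propositional using (_∈_; find; lose)
open import Data.List.Membership.Propositional.Properties
  using (∈-concatMap⁺; ∈-concatMap⁻; ∈-map⁺; ∈-map⁻; ∈-filter⁺; ∈-filter⁻; ∈-++⁺ˡ; ∈-++⁺ʳ;
         ∈-allFin; ∈-upTo⁺; ∈-upTo⁻)
open import Data.List.Membership.Propositional.Properties.WithK using (unique∧set⇒bag)
open import Data.List.Relation.Binary.BagAndSetEquality using (∼bag⇒↭)
open import Data.List.Relation.Binary.Permutation.Propositional
  using (_↭_; prep; swap; ↭-refl; ↭-reflexive; ↭-sym; ↭-trans; ↭⇒↭ₛ′; module PermutationReasoning)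
import Data.List.Relation.Binary.Permutation.Propositional.Properties as Perm
open import Data.List.Relation.Binary.Pointwise using (Pointwise-≡⇒≡)
open import Data.List.Relation.Unary.All as All using (All; []; _∷_)
import Data.List.Relation.Unary.All.Properties as All
open import Data.List.Relation.Unary.AllPairs as AllPairs using (AllPairs; []; _∷_)
import Data.List.Relation.Unary.AllPairs.Properties as AllPairs
open import Data.List.Relation.Unary.Any using (here; there)
open import Data.List.Relation.Unary.Linked using (Linked)
import Data.List.Relation.Unary.Linked.Properties as Linked
open import Data.List.Relation.Unary.Sorted.TotalOrder.Properties using (↗↭↗⇒≋)
open import Data.List.Relation.Unary.Unique.Propositional using (Unique)
import Data.List.Relation.Unary.Unique.Propositional.Properties as Unique
import Data.List.Sort.InsertionSort.Properties as InsertionSort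
open import Data.Maybe using (Maybe; just; nothing)
open import Data.Nat using (ℕ; zero; suc; _+_; _∸_; _≤_; _<_; _≤ᵇ_; _<ᵇ_; z≤n; s≤s; z<s; s<s)
open import Data.Nat.ListAction using (sum)
open import Data.Nat.ListAction.Properties using (sum-↭)
import Data.Nat.Properties as ℕ
open import Data.Product as Product using (_×_; _,_; proj₁; proj₂; ∃; uncurry)
open import Data.Sum as Sum using (_⊎_; inj₁; inj₂)
open import Data.Sum.Properties using (≡-dec)
open import Data.Unit using (⊤; tt)
open import Data.Vec.Properties using (tabulate-cong)
open import Function using (_∘_; _⇔_; case_of_; flip; id; mk⇔; Equivalence)
open import Relation.Binary.Bundles using (DecTotalOrder)
open import Relation.Binary.Construct.Flip.EqAndOrd using (decTotalOrder)
open import Relation.Binary.Definitions using (Decidable; Transitive)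
open import Relation.Binary.PropositionalEquality
  using (_≡_; refl; sym; trans; cong; cong₂; subst)
open import Relation.Nullary using (¬_; Dec; yes; no; does; contradiction)

open Equivalence using (to; from)

private variable
  A B : Set
  P : A → Set
  R : A → A → Set

-- Exchanging the tails of two rows.

data Exchange {A : Set} : (t w t′ w′ : List A) → Set where
  none  : ∀ {t w} → Exchange t w t w
  tails : ∀ {t w} → Exchange t w w t
  _∷_   : ∀ {t w t′ w′} (ab : A × A) → Exchange t w t′ w′ →
          Exchange (proj₁ ab ∷ t) (proj₂ ab ∷ w) (proj₁ ab ∷ t′) (proj₂ ab ∷ w′)

exchange-sym : ∀ {A : Set} {t w t′ w′ : List A} → Exchange t w t′ w′ → Exchange t′ w′ t w
exchange-sym none     = none
exchange-sym tails    = tails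
exchange-sym (ab ∷ e) = ab ∷ exchange-sym e

exchange-↭ : ∀ {A : Set} {t w t′ w′ : List A} → Exchange t w t′ w′ → t ++ w ↭ t′ ++ w′
exchange-↭ none = ↭-refl
exchange-↭ (tails {t} {w}) = Perm.++-comm t w
exchange-↭ (_∷_ {t} {w} {t′} {w′} (a , b) e) =
  prep a (↭-trans (Perm.shift b t w) (↭-trans (prep b (exchange-↭ e)) (↭-sym (Perm.shift b t′ w′))))

-- The prefixes kept in place are equally long, so the lengths are either kept or swapped. This is
-- why sorting a composition tableau only rearranges its parts.
exchange-length : ∀ {A : Set} {t w t′ w′ : List A} → Exchange t w t′ w′ →
  (length t ≡ length t′ × length w ≡ length w′) ⊎ (length t ≡ length w′ × length w ≡ length t′)
exchange-length none     = inj₁ (refl , refl)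
exchange-length tails    = inj₂ (refl , refl)
exchange-length (_ ∷ e) =
  Sum.map (Product.map (cong suc) (cong suc)) (Product.map (cong suc) (cong suc))
    (exchange-length e)

exchange-lengths : ∀ {A : Set} {t w t′ w′ : List A} (ns : List ℕ) → Exchange t w t′ w′ →
                   length t ∷ length w ∷ ns ↭ length t′ ∷ length w′ ∷ ns
exchange-lengths ns e with exchange-length e
... | inj₁ (p , q) rewrite p | q = ↭-refl
... | inj₂ (p , q) rewrite p | q = swap _ _ ↭-refl

-- Meant for conditions that compare a row with a fixed row, reading one entry of the former per
-- column: exchanging tails between two rows that satisfy such a condition cannot break it.
ExchangeClosed : {A : Set} → (List A → Set) → Set
ExchangeClosed P = ∀ {t w t′ w′} → Exchange t w t′ w′ → P t → P w → P t′ × P w′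

-- Row, column and triple conditions over an abstract relation on letters.

module Rows {A : Set} (_⊑_ : A → A → Set) (_⊑?_ : Decidable _⊑_) (⊑-trans : Transitive _⊑_)
  -- In terms of `◁`, these two laws say that `a ◁ b ⊑ c` and `a ⊑ b ◁ c` each give `a ⊑ c`.
  -- Reflexivity of `⊑` is not assumed, since a primed letter cannot follow itself.
  (⋢-⊑-trans : ∀ {a b c} → ¬ b ⊑ a → b ⊑ c → a ⊑ c)
  (⊑-⋢-trans : ∀ {a b c} → a ⊑ b → ¬ c ⊑ b → a ⊑ c) where

  infix 4 _◁_ _◁*_
  _◁_ : A → A → Set
  a ◁ b = ¬ b ⊑ a

  ◁-trans : ∀ {a b c} → a ◁ b → b ◁ c → a ◁ c
  ◁-trans a◁b b◁c c⊑a = a◁b (⋢-⊑-trans b◁c c⊑a)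

  Path : A → List A → Set
  Path a []      = ⊤
  Path a (b ∷ t) = a ⊑ b × Path b t

  -- The empty list is excluded because parts are positive, so every row has an entry in the first
  -- column.
  IsRow : List A → Set
  IsRow []      = ⊥
  IsRow (a ∷ t) = Path a t

  -- The second row is the upper one and may not be longer than the first, so the partition shape of
  -- a tableau is part of this relation.
  _◁*_ : List A → List A → Set
  s       ◁* []      = ⊤
  []      ◁* (_ ∷ _) = ⊥
  (a ∷ s) ◁* (b ∷ u) = a ◁ b × s ◁* u

  -- Here `t` is the lower row and `p` the entry just left of `w` in the upper one. Where the upper
  -- row has just ended, its next entry is ∞ and the conclusion of the rule fails, so the premise
  -- `p ⊑ e` must fail; in later columns the premise itself involves ∞ and nothing is required.
  TripleFrom : A → List A → List A → Set
  TripleFrom p []      w       = ⊤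
  TripleFrom p (e ∷ t) []      = ¬ p ⊑ e
  TripleFrom p (e ∷ t) (b ∷ w) = (p ⊑ e → b ◁ e) × TripleFrom b t w

  Triple : List A → List A → Set
  Triple (a ∷ t) (b ∷ w) = a ◁ b × TripleFrom b t w
  Triple _       _       = ⊥

  ◁*-trans : ∀ s t u → s ◁* t → t ◁* u → s ◁* u
  ◁*-trans s t [] _ _ = tt
  ◁*-trans (a ∷ s) (b ∷ t) (c ∷ u) (ab , st) (bc , tu) = ◁-trans ab bc , ◁*-trans s t u st tu

  path-lower : ∀ {a b} t → a ◁ b → Path b t → Path a t
  path-lower []      a◁b _         = tt
  path-lower (c ∷ t) a◁b (b⊑c , π) = ⋢-⊑-trans a◁b b⊑c , π

  ◁*⇒tripleFrom : ∀ {p} w u → w ◁* u → TripleFrom p u w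
  ◁*⇒tripleFrom w       []      _         = tt
  ◁*⇒tripleFrom (b ∷ w) (e ∷ u) (be , wu) = (λ _ → be) , ◁*⇒tripleFrom w u wu

  -- Once the upper row can step onto an entry of the lower one, the triple rule keeps it
  -- below that row in all later columns.
  path-tripleFrom⇒◁* : ∀ {p} t w → Path p t → TripleFrom p t w → w ◁* t
  path-tripleFrom⇒◁* [] w _ _ = tt
  path-tripleFrom⇒◁* (a ∷ t) [] (p⊑a , _) ¬p⊑a = ⊥-elim (¬p⊑a p⊑a)
  path-tripleFrom⇒◁* (a ∷ t) (b ∷ w) (p⊑a , π) (b◁a , τ) =
    b◁a p⊑a , path-tripleFrom⇒◁* t w (path-lower t (b◁a p⊑a) π) τ

  -- Sorting two rows by exchanging tails, and undoing it.

  ◁*-exchange : ∀ x → ExchangeClosed (x ◁*_)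
  ◁*-exchange x none xt xw = xt , xw
  ◁*-exchange x tails xt xw = xw , xt
  ◁*-exchange (_ ∷ x) (_ ∷ e) (xa , xt) (xb , xw) =
    Product.map (xa ,_) (xb ,_) (◁*-exchange x e xt xw)

  -- For a fixed upper row `x`, the rule reads one entry of the lower row per column. It reads two
  -- neighbouring entries of the upper row, so changes there are handled separately, by the `above`
  -- fields of the records below.
  tripleFrom-exchange : ∀ p x → ExchangeClosed (λ t → TripleFrom p t x)
  tripleFrom-exchange p x none xt xw = xt , xw
  tripleFrom-exchange p x tails xt xw = xw , xt
  tripleFrom-exchange p [] (_ ∷ e) xa xb = xa , xb
  tripleFrom-exchange p (b ∷ x) (_ ∷ e) (xa , xt) (xb , xw) =
    Product.map (xa ,_) (xb ,_) (tripleFrom-exchange b x e xt xw)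

  triple-exchange : ∀ x → ExchangeClosed (λ t → Triple t x)
  triple-exchange x none xt xw = xt , xw
  triple-exchange x tails xt xw = xw , xt
  triple-exchange (b ∷ x) (_ ∷ e) (xa , xt) (xb , xw) =
    Product.map (xa ,_) (xb ,_) (tripleFrom-exchange b x e xt xw)

  -- On a tie between entries that repeat in columns, both a ◁ b and b ◁ a hold; testing b ◁ a makes
  -- the tails swap at the first tie, where unsortTails swaps them back.
  sortTails : List A → List A → List A × List A
  sortTails [] w = w , []
  sortTails (a ∷ t) [] = a ∷ t , []
  sortTails (a ∷ t) (b ∷ w) with a ⊑? b
  ... | yes _ = Product.map (a ∷_) (b ∷_) (sortTails t w)
  ... | no  _ = b ∷ w , a ∷ t

  sortRows : List A → List A → List A × List A
  sortRows (a ∷ t) (b ∷ w) = Product.map (a ∷_) (b ∷_) (sortTails t w)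
  sortRows t       w       = t , w

  -- The argument `p` is the entry of the upper row one column to the left. It is the same before
  -- and after unsorting, because the tails have not been exchanged up to there.
  unsortTails : A → List A → List A → List A × List A
  unsortTails p [] u = [] , u
  unsortTails p (a ∷ s) u with p ⊑? a
  unsortTails p (a ∷ s) u       | yes _ = u , a ∷ s
  unsortTails p (a ∷ s) []      | no  _ = a ∷ s , []
  unsortTails p (a ∷ s) (b ∷ u) | no  _ = Product.map (a ∷_) (b ∷_) (unsortTails b s u)

  unsortRows : List A → List A → List A × List A
  unsortRows (a ∷ s) (b ∷ u) = Product.map (a ∷_) (b ∷_) (unsortTails b s u)
  unsortRows s       u       = s , u

  sortTails-exchange : ∀ t w → uncurry (Exchange t w) (sortTails t w)
  sortTails-exchange [] w = tails
  sortTails-exchange (a ∷ t) [] = none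
  sortTails-exchange (a ∷ t) (b ∷ w) with a ⊑? b
  ... | yes _ = (a , b) ∷ sortTails-exchange t w
  ... | no  _ = tails

  sortRows-exchange : ∀ t w → uncurry (Exchange t w) (sortRows t w)
  sortRows-exchange [] w = none
  sortRows-exchange (a ∷ t) [] = none
  sortRows-exchange (a ∷ t) (b ∷ w) = (a , b) ∷ sortTails-exchange t w

  unsortTails-exchange : ∀ p s u → uncurry (Exchange s u) (unsortTails p s u)
  unsortTails-exchange p [] u = none
  unsortTails-exchange p (a ∷ s) u with p ⊑? a
  unsortTails-exchange p (a ∷ s) u       | yes _ = tails
  unsortTails-exchange p (a ∷ s) []      | no  _ = none
  unsortTails-exchange p (a ∷ s) (b ∷ u) | no  _ = (a , b) ∷ unsortTails-exchange b s u

  unsortRows-exchange : ∀ s u → uncurry (Exchange s u) (unsortRows s u)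
  unsortRows-exchange [] u = none
  unsortRows-exchange (a ∷ s) [] = none
  unsortRows-exchange (a ∷ s) (b ∷ u) = (a , b) ∷ unsortTails-exchange b s u

  -- The entries `c` and `p` precede the lower and the upper tail. In `above`, `u` is a row of the
  -- sorted tableau above `t`, which the inserted row has yet to pass: after the comparison with
  -- `t`, `hi` must still obey the triple rule over `u`, and `lo` must lie below `u`.
  record Sorted (c p : A) (t w lo hi : List A) : Set where
    constructor sorted
    field
      pathˡ : Path c lo
      pathʰ : Path p hi
      lo◁hi : lo ◁* hi
      undo  : unsortTails p lo hi ≡ (t , w)
      above : ∀ u → t ◁* u → TripleFrom p u w → TripleFrom p u hi × lo ◁* u

  -- While `a ⊑ b`, the triple rule excludes `p ⊑ a`, so `unsortTails` passes the same column. At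
  -- the first `b ◁ a`, `p ⊑ b ◁ a` gives `p ⊑ a`, and `path-tripleFrom⇒◁*` puts the whole rest of
  -- the upper row below the lower one. Since `p ⊑ b`, this is also where `unsortTails` exchanges
  -- the tails back.
  sortTails-sorted : ∀ {c p} t w → c ◁ p → Path c t → Path p w → TripleFrom p t w →
                     uncurry (Sorted c p t w) (sortTails t w)
  sortTails-sorted {c} {p} [] w c◁p _ πw _ =
    -- The lower tail is empty, so `[] ◁* u` leaves only an empty `u`.
    sorted (path-lower w c◁p πw) tt tt (undo w πw) λ { [] _ _ → tt , tt }
    where
    undo : ∀ w → Path p w → unsortTails p w [] ≡ ([] , w)
    undo [] _ = refl
    undo (b ∷ w) (p⊑b , _) with p ⊑? b
    ... | yes _    = refl
    ... | no ¬p⊑b = contradiction p⊑b ¬p⊑b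
  sortTails-sorted {c} {p} (a ∷ t) [] c◁p πt _ ¬p⊑a = sorted πt tt tt undo λ u tu τ → τ , tu
    where
    undo : unsortTails p (a ∷ t) [] ≡ (a ∷ t , [])
    undo with p ⊑? a
    ... | yes p⊑a = contradiction p⊑a ¬p⊑a
    ... | no _    = refl
  sortTails-sorted {c} {p} (a ∷ t) (b ∷ w) c◁p (c⊑a , πt) (p⊑b , πw) (τ , τs) with a ⊑? b
  ... | yes a⊑b = sorted (c⊑a , pathˡ) (p⊑b , pathʰ) (a◁b , lo◁hi) undo′ above′
    where
    p⋢a : ¬ p ⊑ a
    p⋢a p⊑a = τ p⊑a a⊑b
    a◁b : a ◁ b
    a◁b b⊑a = p⋢a (⊑-trans p⊑b b⊑a)
    open Sorted (sortTails-sorted t w a◁b πt πw τs)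
    lo = proj₁ (sortTails t w)
    hi = proj₂ (sortTails t w)
    undo′ : unsortTails p (a ∷ lo) (b ∷ hi) ≡ (a ∷ t , b ∷ w)
    undo′ with p ⊑? a
    ... | yes p⊑a = contradiction p⊑a p⋢a
    ... | no _    = cong (Product.map (a ∷_) (b ∷_)) undo
    above′ : ∀ u → (a ∷ t) ◁* u → TripleFrom p u (b ∷ w) → TripleFrom p u (b ∷ hi) × (a ∷ lo) ◁* u
    above′ [] _ _ = tt , tt
    above′ (e ∷ u) (a◁e , tu) (σ , σs) = Product.map (σ ,_) (a◁e ,_) (above u tu σs)
  ... | no b◁a = sorted (path-lower (b ∷ w) c◁p (p⊑b , πw)) πa w◁t undo′ above′
    where
    πa : Path p (a ∷ t)
    πa = ⊑-⋢-trans p⊑b b◁a , πt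
    w◁t : (b ∷ w) ◁* (a ∷ t)
    w◁t = path-tripleFrom⇒◁* (a ∷ t) (b ∷ w) πa (τ , τs)
    undo′ : unsortTails p (b ∷ w) (a ∷ t) ≡ (a ∷ t , b ∷ w)
    undo′ with p ⊑? b
    ... | yes _    = refl
    ... | no ¬p⊑b = contradiction p⊑b ¬p⊑b
    above′ : ∀ u → (a ∷ t) ◁* u → TripleFrom p u (b ∷ w) → TripleFrom p u (a ∷ t) × (b ∷ w) ◁* u
    above′ u tu _ = ◁*⇒tripleFrom (a ∷ t) u tu , ◁*-trans (b ∷ w) (a ∷ t) u w◁t tu

  -- Here `v` has been extracted from the rows above `s`, and `u` is one of the rows left behind.
  -- When the tails are exchanged, `v` becomes part of the lower row and must lie below `u`; this
  -- follows from `path-tripleFrom⇒◁*`, for which `above` assumes that `u` is a path.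
  record Unsorted (c p : A) (s v t w : List A) : Set where
    constructor unsorted
    field
      pathˡ  : Path c t
      pathʰ  : Path p w
      triple : TripleFrom p t w
      redo   : sortTails t w ≡ (s , v)
      above  : ∀ u → s ◁* u → TripleFrom p u v → Path c u → TripleFrom p u w × t ◁* u

  -- If `p ⊑ a`, the exchange happens, and `a ◁ b` makes `sortTails` exchange back in the same
  -- column. Otherwise the premise of the triple rule fails at `a`, and an upper entry `b` has
  -- `p ⊑ b`, hence `a ⊑ b`, so `sortTails` passes the column too.
  unsortTails-unsorted : ∀ {c p} s v → c ◁ p → Path c s → Path p v → s ◁* v →
                         uncurry (Unsorted c p s v) (unsortTails p s v)
  unsortTails-unsorted [] [] _ _ _ _ = unsorted tt tt tt refl λ { [] _ _ _ → tt , tt }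
  unsortTails-unsorted {c} {p} (a ∷ s) v c◁p (c⊑a , πs) πv sv with p ⊑? a
  unsortTails-unsorted {c} {p} (a ∷ s) v c◁p (c⊑a , πs) πv sv | yes p⊑a =
    unsorted (path-lower v c◁p πv) (p⊑a , πs) (◁*⇒tripleFrom (a ∷ s) v sv) (redo v sv) above
    where
    redo : ∀ v → (a ∷ s) ◁* v → sortTails v (a ∷ s) ≡ (a ∷ s , v)
    redo [] _ = refl
    redo (b ∷ v) (a◁b , _) with b ⊑? a
    ... | yes b⊑a = contradiction b⊑a a◁b
    ... | no _    = refl
    above : ∀ u → (a ∷ s) ◁* u → TripleFrom p u v → Path c u → TripleFrom p u (a ∷ s) × v ◁* u
    above [] _ _ _ = tt , tt
    above (e ∷ u) (a◁e , su) τ (_ , πu) =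
      ◁*⇒tripleFrom (a ∷ s) (e ∷ u) (a◁e , su) ,
      path-tripleFrom⇒◁* (e ∷ u) v (⊑-⋢-trans p⊑a a◁e , πu) τ
  unsortTails-unsorted {c} {p} (a ∷ s) [] c◁p (c⊑a , πs) πv sv | no ¬p⊑a =
    unsorted (c⊑a , πs) tt ¬p⊑a refl λ u su τ _ → τ , su
  unsortTails-unsorted {c} {p} (a ∷ s) (b ∷ v) c◁p (c⊑a , πs) (p⊑b , πv) (a◁b , sv) | no ¬p⊑a =
    unsorted (c⊑a , pathˡ) (p⊑b , pathʰ) ((λ p⊑a → contradiction p⊑a ¬p⊑a) , triple) redo′ above′
    where
    open Unsorted (unsortTails-unsorted s v a◁b πs πv sv)
    t = proj₁ (unsortTails b s v)
    w = proj₂ (unsortTails b s v)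
    redo′ : sortTails (a ∷ t) (b ∷ w) ≡ (a ∷ s , b ∷ v)
    redo′ with a ⊑? b
    ... | yes _    = cong (Product.map (a ∷_) (b ∷_)) redo
    ... | no ¬a⊑b = contradiction (⋢-⊑-trans ¬p⊑a p⊑b) ¬a⊑b
    above′ : ∀ u → (a ∷ s) ◁* u → TripleFrom p u (b ∷ v) → Path c u →
             TripleFrom p u (b ∷ w) × (a ∷ t) ◁* u
    above′ [] _ _ _ = tt , tt
    above′ (e ∷ u) (a◁e , su) (σ , σs) (_ , πu) =
      Product.map (σ ,_) (a◁e ,_) (above u su σs (path-lower u a◁e πu))

  record RowsSorted (t w lo hi : List A) : Set where
    constructor rowsSorted
    field
      rowˡ  : IsRow lo
      rowʰ  : IsRow hi
      lo◁hi : lo ◁* hi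
      undo  : unsortRows lo hi ≡ (t , w)
      above : ∀ u → t ◁* u → Triple u w → Triple u hi × lo ◁* u

  sortRows-sorted : ∀ t w → IsRow t → IsRow w → Triple t w → uncurry (RowsSorted t w) (sortRows t w)
  sortRows-sorted (a ∷ t) (b ∷ w) πt πw (a◁b , τ) =
    rowsSorted pathˡ pathʰ (a◁b , lo◁hi) (cong (Product.map (a ∷_) (b ∷_)) undo)
      λ { (e ∷ u) (a◁e , tu) (e◁b , σ) → Product.map (e◁b ,_) (a◁e ,_) (above u tu σ) }
    where open Sorted (sortTails-sorted t w a◁b πt πw τ)

  record RowsUnsorted (s v t w : List A) : Set where
    constructor rowsUnsorted
    field
      rowˡ   : IsRow t
      rowʰ   : IsRow w
      triple : Triple t w
      redo   : sortRows t w ≡ (s , v)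
      above  : ∀ u → IsRow u → s ◁* u → Triple u v → Triple u w × t ◁* u

  unsortRows-unsorted : ∀ s v → IsRow s → IsRow v → s ◁* v →
                        uncurry (RowsUnsorted s v) (unsortRows s v)
  unsortRows-unsorted (a ∷ s) (b ∷ v) πs πv (a◁b , sv) =
    rowsUnsorted pathˡ pathʰ (a◁b , triple) (cong (Product.map (a ∷_) (b ∷_)) redo)
      λ { (e ∷ u) πu (a◁e , su) (e◁b , σ) →
          Product.map (e◁b ,_) (a◁e ,_) (above u su σ (path-lower u a◁e πu)) }
    where open Unsorted (unsortTails-unsorted s v a◁b πs πv sv)

  -- Inserting a row into a tableau and extracting it again.

  insert : List A → List (List A) → List (List A)
  insert w []      = w ∷ []
  insert w (t ∷ T) = proj₁ (sortRows t w) ∷ insert (proj₂ (sortRows t w)) T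

  -- The bottom row is a separate argument, so that the tableau is non-empty. The recursive call
  -- comes first: the walk starts at the top row and undoes the comparisons of `insert` in reverse
  -- order.
  extract : List A → List (List A) → List A × List (List A)
  extract s []      = s , []
  extract s (u ∷ T) =
    let v , T′ = extract u T ; t , w = unsortRows s v in w , t ∷ T′

  -- The argument lists rows from the top down, so each row is inserted after all rows below it. The
  -- result lists rows from the bottom up.
  sortColumns : List (List A) → List (List A)
  sortColumns = foldr insert []

  -- Insertion, extraction and column sorting are chains of exchanges, which are reversible. In
  -- particular, the triple rule for a fixed upper row holds over the rows of `F` exactly when it
  -- holds over those of `sortColumns F`.
  module _ {P : List A → Set} (closed : ExchangeClosed P) where

    insert-All : ∀ {w} T → P w → All P T → All P (insert w T)
    insert-All []      pw []        = pw ∷ []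
    insert-All (t ∷ T) pw (pt ∷ ps) =
      let plo , phi = closed (sortRows-exchange t _) pt pw in plo ∷ insert-All T phi ps

    insert-All⁻ : ∀ {w} T → All P (insert w T) → P w × All P T
    insert-All⁻ []      (pw ∷ [])  = pw , []
    insert-All⁻ {w} (t ∷ T) (plo ∷ ps) =
      let phi , psT = insert-All⁻ T ps
          pt , pw = closed (exchange-sym (sortRows-exchange t w)) plo phi
      in pw , pt ∷ psT

    extract-All : ∀ s T → P s → All P T → P (proj₁ (extract s T)) × All P (proj₂ (extract s T))
    extract-All s []      ps []        = ps , []
    extract-All s (u ∷ T) ps (pu ∷ pT) =
      let pv , pT′ = extract-All u T pu pT
          pt , pw = closed (unsortRows-exchange s (proj₁ (extract u T))) ps pv
      in pw , pt ∷ pT′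

    sortColumns-All : ∀ F → All P F → All P (sortColumns F)
    sortColumns-All []      []        = []
    sortColumns-All (w ∷ F) (pw ∷ pF) = insert-All (sortColumns F) pw (sortColumns-All F pF)

    sortColumns-All⁻ : ∀ F → All P (sortColumns F) → All P F
    sortColumns-All⁻ []      []  = []
    sortColumns-All⁻ (w ∷ F) pwF =
      let pw , pF = insert-All⁻ (sortColumns F) pwF in pw ∷ sortColumns-All⁻ F pF

  IsTableau : List (List A) → Set
  IsTableau T = All IsRow T × AllPairs _◁*_ T

  -- Rows are listed from the top down here.
  IsComposition : List (List A) → Set
  IsComposition F = All IsRow F × AllPairs (λ w t → Triple t w) F

  -- The field `above` passes the triple rule on to `hi` and places `lo` below every remaining row.
  -- The rest of the insertion only exchanges tails among rows that `lo` lies below.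
  insert-tableau : ∀ w T → IsRow w → IsTableau T → All (λ t → Triple t w) T → IsTableau (insert w T)
  insert-tableau w [] rw _ _ = rw ∷ [] , [] ∷ []
  insert-tableau w (t ∷ T) rw (rt ∷ rT , tT ∷ TT) (τ ∷ τs) =
    let rs , cs = insert-tableau hi T rowʰ (rT , TT) (All.map proj₁ above′) in
    rowˡ ∷ rs , insert-All (◁*-exchange lo) T lo◁hi (All.map proj₂ above′) ∷ cs
    where
    open RowsSorted (sortRows-sorted t w rt rw τ)
    lo = proj₁ (sortRows t w)
    hi = proj₂ (sortRows t w)
    above′ : All (λ u → Triple u hi × lo ◁* u) T
    above′ = All.zipWith (λ (tu , τ) → above _ tu τ) (tT , τs)

  insert-head : ∀ w T → ∃ λ s → ∃ λ S → insert w T ≡ s ∷ S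
  insert-head w []      = _ , _ , refl
  insert-head w (t ∷ T) = _ , _ , refl

  extract-insert : ∀ w T s S → insert w T ≡ s ∷ S → IsRow w → IsTableau T →
                   All (λ t → Triple t w) T → extract s S ≡ (w , T)
  extract-insert w [] _ _ refl _ _ _ = refl
  extract-insert w (t ∷ T) _ _ refl rw (rt ∷ rT , tT ∷ TT) (τ ∷ τs) =
    step _ refl
    where
    open RowsSorted (sortRows-sorted t w rt rw τ)
    lo = proj₁ (sortRows t w)
    hi = proj₂ (sortRows t w)
    -- Naming the inserted list `R` lets `extract` unfold on its bottom row; `R` is never empty.
    step : ∀ R → insert hi T ≡ R → extract lo R ≡ (w , t ∷ T)
    step [] eq = case trans (sym eq) (proj₂ (proj₂ (insert-head hi T))) of λ ()
    step (u ∷ R) eq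
      rewrite extract-insert hi T u R eq rowʰ (rT , TT)
                (All.zipWith (λ (tu , τ) → proj₁ (above _ tu τ)) (tT , τs))
            | undo = refl

  record Extracted (s : List A) (T : List (List A)) (w : List A) (T′ : List (List A)) : Set where
    constructor extracted
    field
      row      : IsRow w
      tableau  : IsTableau T′
      triples  : All (λ t → Triple t w) T′
      reinsert : insert w T′ ≡ s ∷ T
      size     : length T′ ≡ length T

  -- By induction from the top: the row `v` extracted from `u ∷ T` is unsorted against `s`, and
  -- `above` restores the conditions between the two results and the rows of `T′`.
  extract-extracted : ∀ s T → IsTableau (s ∷ T) → uncurry (Extracted s T) (extract s T)
  extract-extracted s [] (rs ∷ _ , _) = extracted rs ([] , []) [] refl refl
  extract-extracted s (u ∷ T) (rs ∷ rT , sT ∷ TT) = extracted rowʰ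
      (rowˡ ∷ proj₁ tableau , All.map proj₂ above′ ∷ proj₂ tableau)
      (triple ∷ All.map proj₁ above′) reinsert′ (cong suc size)
    where
    open Extracted (extract-extracted u T (rT , TT))
    v  = proj₁ (extract u T)
    T′ = proj₂ (extract u T)
    -- Extraction exchanges tails only among rows that `s` lies below.
    s◁ : s ◁* v × All (s ◁*_) T′
    s◁ = extract-All (◁*-exchange s) u T (All.head sT) (All.tail sT)
    open RowsUnsorted (unsortRows-unsorted s v rs row (proj₁ s◁))
    t = proj₁ (unsortRows s v)
    w = proj₂ (unsortRows s v)
    above′ : All (λ u → Triple u w × t ◁* u) T′
    above′ = All.zipWith (λ (ru , su , τ) → above _ ru su τ)
               (proj₁ tableau , All.zip (proj₂ s◁ , triples))
    reinsert′ : insert w (t ∷ T′) ≡ s ∷ u ∷ T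
    reinsert′ rewrite redo = cong (s ∷_) reinsert

  -- Sorting columns is a bijection from composition tableaux onto tableaux.

  sortColumns-tableau : ∀ F → IsComposition F → IsTableau (sortColumns F)
  sortColumns-tableau [] _ = [] , []
  sortColumns-tableau (w ∷ F) (rw ∷ rF , τ ∷ τs) =
    insert-tableau w (sortColumns F) rw (sortColumns-tableau F (rF , τs))
      (sortColumns-All (triple-exchange w) F τ)

  -- The image determines the top row and the sorted remainder, both of which `extract` returns.
  sortColumns-injective : ∀ {F F′} → IsComposition F → IsComposition F′ →
                          sortColumns F ≡ sortColumns F′ → F ≡ F′
  sortColumns-injective {[]} {[]} _ _ _ = refl
  sortColumns-injective {[]} {w ∷ F} _ _ eq
    with insert-head w (sortColumns F)
  ... | _ , _ , eq′ = contradiction (trans eq eq′) λ ()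
  sortColumns-injective {w ∷ F} {[]} _ _ eq
    with insert-head w (sortColumns F)
  ... | _ , _ , eq′ = contradiction (trans (sym eq) eq′) λ ()
  sortColumns-injective {w ∷ F} {w′ ∷ F′} c@(_ ∷ rF , _ ∷ τF) c′@(_ ∷ rF′ , _ ∷ τF′) eq
    with insert-head w (sortColumns F)
  ... | s , S , eq′ = cong₂ _∷_ (cong proj₁ same)
        (sortColumns-injective (rF , τF) (rF′ , τF′) (cong proj₂ same))
    where
    extracts : ∀ v G → IsComposition (v ∷ G) → insert v (sortColumns G) ≡ s ∷ S →
               extract s S ≡ (v , sortColumns G)
    extracts v G (rv ∷ rG , τ ∷ τs) e = extract-insert v (sortColumns G) s S e rv
      (sortColumns-tableau G (rG , τs)) (sortColumns-All (triple-exchange v) G τ)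
    same : (w , sortColumns F) ≡ (w′ , sortColumns F′)
    same = trans (sym (extracts w F c eq′)) (extracts w′ F′ c′ (trans (sym eq) eq′))

  sortColumns-surjective : ∀ T → IsTableau T → ∃ λ F → IsComposition F × sortColumns F ≡ T
  sortColumns-surjective T = go (length T) T refl
    where
    -- The remainder after extraction is not a sublist of `T`, so the recursion is on the number of
    -- rows.
    go : ∀ n T → length T ≡ n → IsTableau T → ∃ λ F → IsComposition F × sortColumns F ≡ T
    go zero [] _ _ = [] , ([] , []) , refl
    go (suc n) (s ∷ T) |T| tab =
      let open Extracted (extract-extracted s T tab)
          w = proj₁ (extract s T)
          F , (rF , τF) , eq = go n (proj₂ (extract s T)) (trans size (ℕ.suc-injective |T|)) tableau
      in w ∷ F
       -- `triples` concerns the sorted remainder; reversing the exchanges carries it over to the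
       -- rows of `F`.
       , (row ∷ rF , sortColumns-All⁻ (triple-exchange w) F
            (subst (All (λ t → Triple t w)) (sym eq) triples) ∷ τF)
       , trans (cong (insert w) eq) reinsert

  -- Sorting preserves the letters and the row lengths up to order.

  insert-concat-↭ : ∀ w T → concat (insert w T) ↭ w ++ concat T
  insert-concat-↭ w [] = ↭-refl
  insert-concat-↭ w (t ∷ T) = begin
    lo ++ concat (insert hi T)  ↭⟨ Perm.++⁺ˡ lo (insert-concat-↭ hi T) ⟩
    lo ++ hi ++ concat T        ↭⟨ ↭-sym (Perm.++-assoc lo hi (concat T)) ⟩
    (lo ++ hi) ++ concat T
      ↭⟨ Perm.++⁺ʳ (concat T) (↭-sym (exchange-↭ (sortRows-exchange t w))) ⟩
    (t ++ w) ++ concat T        ↭⟨ Perm.++⁺ʳ (concat T) (Perm.++-comm t w) ⟩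
    (w ++ t) ++ concat T        ↭⟨ Perm.++-assoc w t (concat T) ⟩
    w ++ t ++ concat T          ∎
    where
    open PermutationReasoning
    lo = proj₁ (sortRows t w)
    hi = proj₂ (sortRows t w)

  insert-lengths-↭ : ∀ w T → map length (insert w T) ↭ length w ∷ map length T
  insert-lengths-↭ w [] = ↭-refl
  insert-lengths-↭ w (t ∷ T) = begin
    length lo ∷ map length (insert hi T)    ↭⟨ prep _ (insert-lengths-↭ hi T) ⟩
    length lo ∷ length hi ∷ map length T
      ↭⟨ exchange-lengths _ (exchange-sym (sortRows-exchange t w)) ⟩
    length t ∷ length w ∷ map length T      ↭⟨ swap _ _ ↭-refl ⟩
    length w ∷ length t ∷ map length T      ∎
    where
    open PermutationReasoning
    lo = proj₁ (sortRows t w)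
    hi = proj₂ (sortRows t w)

  sortColumns-concat-↭ : ∀ F → concat (sortColumns F) ↭ concat F
  sortColumns-concat-↭ [] = ↭-refl
  sortColumns-concat-↭ (w ∷ F) =
    ↭-trans (insert-concat-↭ w (sortColumns F)) (Perm.++⁺ˡ w (sortColumns-concat-↭ F))

  sortColumns-lengths-↭ : ∀ F → map length (sortColumns F) ↭ map length F
  sortColumns-lengths-↭ [] = ↭-refl
  sortColumns-lengths-↭ (w ∷ F) =
    ↭-trans (insert-lengths-↭ w (sortColumns F)) (prep _ (sortColumns-lengths-↭ F))

-- Lists without repetition.

∈-concatMap⇔ : (f : A → List B) (xs : List A) {y : B} →
               y ∈ concatMap f xs ⇔ (∃ λ x → x ∈ xs × y ∈ f x)
∈-concatMap⇔ f xs =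
  mk⇔ (find ∘ ∈-concatMap⁻ f {xs}) λ (_ , x∈ , y∈) → ∈-concatMap⁺ f (lose x∈ y∈)

concatMap-unique : (f : A → List B) → (∀ x → Unique (f x)) →
                   (∀ {x x′ y} → y ∈ f x → y ∈ f x′ → x ≡ x′) →
                   ∀ {xs} → Unique xs → Unique (concatMap f xs)
concatMap-unique f uf disj {xs} u = Unique.concat⁺ (All.map⁺ (All.universal uf xs))
  (AllPairs.map⁺ (AllPairs.map (λ x≢x′ {_} (y∈ , y∈′) → x≢x′ (disj y∈ y∈′)) u))

map-unique : (f : A → B) {xs : List A} → (∀ {x y} → x ∈ xs → y ∈ xs → f x ≡ f y → x ≡ y) →
             Unique xs → Unique (map f xs)
map-unique f inj [] = []
map-unique f {x ∷ xs} inj (x∉ ∷ u) =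
  All.map⁺ (All.tabulate λ y∈ eq → All.lookup x∉ y∈ (inj (here refl) (there y∈) eq)) ∷
  map-unique f (λ p q → inj (there p) (there q)) u

-- Two lists without repetition are permutations of each other as soon as they have the same
-- members.
↭-map-bijection : (g : B → A) {xs : List A} {ys : List B} → Unique xs → Unique ys →
  (∀ {y} → y ∈ ys → g y ∈ xs) →
  (∀ {y y′} → y ∈ ys → y′ ∈ ys → g y ≡ g y′ → y ≡ y′) →
  (∀ {x} → x ∈ xs → ∃ λ y → y ∈ ys × g y ≡ x) → xs ↭ map g ys
↭-map-bijection g uxs uys into inj onto =
  ∼bag⇒↭ (unique∧set⇒bag uxs (map-unique g inj uys) (mk⇔
    (λ x∈ → let y , y∈ , eq = onto x∈ in subst (_∈ _) eq (∈-map⁺ g y∈))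
    (λ x∈ → let y , y∈ , eq = ∈-map⁻ g x∈ in subst (_∈ _) (sym eq) (into y∈))))

filterᵇ-unique : (p : A → Bool) {xs : List A} → Unique xs → Unique (filterᵇ p xs)
filterᵇ-unique p = Unique.filter⁺ (T? ∘ p)

∈-filterᵇ⇔ : (p : A → Bool) (xs : List A) {x : A} → x ∈ filterᵇ p xs ⇔ (x ∈ xs × T (p x))
∈-filterᵇ⇔ p xs = mk⇔ (∈-filter⁻ (T? ∘ p) {xs = xs}) λ (x∈ , px) → ∈-filter⁺ (T? ∘ p) x∈ px

-- Enumerations of words, fillings and compositions.

letters : (k l : ℕ) → List (Letter k l)
letters k l = map inj₁ (allFin k) ++ map inj₂ (allFin l)

∈-letters : ∀ {k l} (a : Letter k l) → a ∈ letters k l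
∈-letters (inj₁ i) = ∈-++⁺ˡ (∈-map⁺ inj₁ (∈-allFin i))
∈-letters {k} (inj₂ i) = ∈-++⁺ʳ (map inj₁ (allFin k)) (∈-map⁺ inj₂ (∈-allFin i))

letters-unique : ∀ k l → Unique (letters k l)
letters-unique k l = Unique.++⁺ (Unique.map⁺ (λ { refl → refl }) (Unique.allFin⁺ k))
  (Unique.map⁺ (λ { refl → refl }) (Unique.allFin⁺ l))
  λ (p , q) → case (∈-map⁻ inj₁ p) (∈-map⁻ inj₂ q)
  where
  case : ∀ {v : Letter k l} → (∃ λ i → i ∈ allFin k × v ≡ inj₁ i) →
         ¬ (∃ λ i → i ∈ allFin l × v ≡ inj₂ i)
  case (_ , _ , refl) (_ , _ , ())

map-∷-head : ∀ {x x′ : A} {xss xss′ : List (List A)} {ys : List A} →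
             ys ∈ map (x ∷_) xss → ys ∈ map (x′ ∷_) xss′ → x ≡ x′
map-∷-head {x = x} {x′} p q with ∈-map⁻ (x ∷_) p | ∈-map⁻ (x′ ∷_) q
... | _ , _ , refl | _ , _ , refl = refl

∈-words⇔ : ∀ {k l} n {w} → w ∈ words k l n ⇔ length w ≡ n
∈-words⇔ {k} {l} n = mk⇔ (⇒ n) (⇐ n _)
  where
  ⇒ : ∀ n {w} → w ∈ words k l n → length w ≡ n
  ⇒ zero (here refl) = refl
  ⇒ (suc n) w∈ with to (∈-concatMap⇔ (λ a → map (a ∷_) (words k l n)) (letters k l)) w∈
  ... | a , _ , w∈′ with ∈-map⁻ (a ∷_) w∈′
  ... | v , v∈ , refl = cong suc (⇒ n v∈)
  ⇐ : ∀ n w → length w ≡ n → w ∈ words k l n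
  ⇐ zero [] refl = here refl
  ⇐ (suc n) (a ∷ w) eq =
    from (∈-concatMap⇔ (λ a → map (a ∷_) (words k l n)) (letters k l))
      (a , ∈-letters a , ∈-map⁺ (a ∷_) (⇐ n w (ℕ.suc-injective eq)))

words-unique : ∀ k l n → Unique (words k l n)
words-unique k l zero    = [] ∷ []
words-unique k l (suc n) = concatMap-unique (λ a → map (a ∷_) (words k l n))
  (λ a → Unique.map⁺ List.∷-injectiveʳ (words-unique k l n)) map-∷-head (letters-unique k l)

∈-fillings⇔ : ∀ {k l} s {F} → F ∈ fillings k l s ⇔ map length F ≡ s
∈-fillings⇔ {k} {l} s = mk⇔ (⇒ s) (⇐ s _)
  where
  ⇒ : ∀ s {F} → F ∈ fillings k l s → map length F ≡ s
  ⇒ [] (here refl) = refl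
  ⇒ (n ∷ s) F∈ with to (∈-concatMap⇔ (λ w → map (w ∷_) (fillings k l s)) (words k l n)) F∈
  ... | w , w∈ , F∈′ with ∈-map⁻ (w ∷_) F∈′
  ... | G , G∈ , refl = cong₂ _∷_ (to (∈-words⇔ n) w∈) (⇒ s G∈)
  ⇐ : ∀ s F → map length F ≡ s → F ∈ fillings k l s
  ⇐ [] [] refl = here refl
  ⇐ (n ∷ s) (w ∷ F) eq = from (∈-concatMap⇔ (λ w → map (w ∷_) (fillings k l s)) (words k l n))
    (w , from (∈-words⇔ n) (List.∷-injectiveˡ eq) , ∈-map⁺ (w ∷_) (⇐ s F (List.∷-injectiveʳ eq)))

fillings-unique : ∀ k l s → Unique (fillings k l s)
fillings-unique k l []      = [] ∷ []
fillings-unique k l (n ∷ s) = concatMap-unique (λ w → map (w ∷_) (fillings k l s))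
  (λ w → Unique.map⁺ List.∷-injectiveʳ (fillings-unique k l s)) map-∷-head (words-unique k l n)

-- Every part is at least 1, so one unit of fuel per part suffices.
∈-compsFuel : ∀ f α → All (0 <_) α → sum α ≤ f → α ∈ compsFuel f (sum α)
∈-compsFuel zero    [] _ _ = here refl
∈-compsFuel (suc f) [] _ _ = here refl
∈-compsFuel zero (_ ∷ α) (s≤s _ ∷ _) ()
∈-compsFuel (suc f) (suc p ∷ α) (_ ∷ α+) (s≤s le) = from
  (∈-concatMap⇔ (λ q → map (suc q ∷_) (compsFuel f (p + sum α ∸ q))) (upTo (suc (p + sum α))))
  ( p , ∈-upTo⁺ (s≤s (ℕ.m≤m+n p (sum α)))
  , ∈-map⁺ (suc p ∷_) (subst (λ n → α ∈ compsFuel f n) (sym (ℕ.m+n∸m≡n p (sum α)))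
      (∈-compsFuel f α α+ (ℕ.≤-trans (ℕ.m≤n+m (sum α) p) le))))

compsFuel-unique : ∀ f n → Unique (compsFuel f n)
compsFuel-unique zero    zero    = [] ∷ []
compsFuel-unique (suc f) zero    = [] ∷ []
compsFuel-unique zero    (suc n) = []
compsFuel-unique (suc f) (suc n) = concatMap-unique (λ p → map (suc p ∷_) (compsFuel f (n ∸ p)))
  (λ p → Unique.map⁺ List.∷-injectiveʳ (compsFuel-unique f (n ∸ p)))
  (λ p q → ℕ.suc-injective (map-∷-head p q)) (Unique.upTo⁺ (suc n))

sortDec-↭ : ∀ α → sortDec α ↭ α
sortDec-↭ = InsertionSort.sort-↭ (decTotalOrder ℕ.≤-decTotalOrder)

-- Two sorted lists that are permutations of each other are equal.
sortDec-unique : ∀ {α la} → Linked _≥ℕ_ la → α ↭ la → sortDec α ≡ la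
sortDec-unique {α} la↘ α↭la = Pointwise-≡⇒≡
  (↗↭↗⇒≋ O.totalOrder (InsertionSort.sort-↗ O α) la↘
    (↭⇒↭ₛ′ O.Eq.isEquivalence (↭-trans (sortDec-↭ α) α↭la)))
  where
  O = decTotalOrder ℕ.≤-decTotalOrder
  module O = DecTotalOrder O

T-does⇔ : ∀ {P : Set} (P? : Dec P) → T (does P?) ⇔ P
T-does⇔ (yes p) = mk⇔ (λ _ → p) (λ _ → _)
T-does⇔ (no ¬p) = mk⇔ (λ ()) ¬p

∈-compositionsOf⇔ : ∀ {la α} → IsPartition la → α ∈ compositionsOf la ⇔ (α ↭ la)
∈-compositionsOf⇔ {la} {α} (la+ , la↘) = mk⇔
  (λ α∈ → let _ , t = to (∈-filterᵇ⇔ _ (compositions (sum la))) α∈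
           in ↭-trans (↭-sym (sortDec-↭ α))
                (↭-reflexive (to (T-does⇔ (List.≡-dec ℕ._≟_ (sortDec α) la)) t)))
  (λ α↭la → from (∈-filterᵇ⇔ _ (compositions (sum la)))
    ( subst (λ n → α ∈ compositions n) (sum-↭ α↭la)
        (∈-compsFuel (sum α) α (Perm.All-resp-↭ (↭-sym α↭la) la+) ℕ.≤-refl)
    , from (T-does⇔ (List.≡-dec ℕ._≟_ (sortDec α) la)) (sortDec-unique la↘ α↭la)))

compositionsOf-unique : ∀ la → Unique (compositionsOf la)
compositionsOf-unique la = filterᵇ-unique _ (compsFuel-unique (sum la) (sum la))

-- Weights, reversal, and translation of the Boolean checks.

weight-↭ : ∀ {k l} (F G : Filling k l) → concat F ↭ concat G → weight F ≡ weight G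
weight-↭ F G F↭G =
  cong₂ _,_ (tabulate-cong λ i → count (inj₁ i)) (tabulate-cong λ i → count (inj₂ i))
  where
  count : ∀ a → countLetter a F ≡ countLetter a G
  count a = Perm.↭-length (Perm.filter-↭ (λ b → ≡-dec _≟F_ _≟F_ b a) F↭G)

concat-↭ : {F G : List (List A)} → F ↭ G → concat F ↭ concat G
concat-↭ _↭_.refl        = ↭-refl
concat-↭ (prep t p)      = Perm.++⁺ˡ t (concat-↭ p)
concat-↭ (swap t w p)    = ↭-trans (Perm.++⁺ˡ t (Perm.++⁺ˡ w (concat-↭ p))) (Perm.shifts t w)
concat-↭ (_↭_.trans p q) = ↭-trans (concat-↭ p) (concat-↭ q)

AllPairs-reverse : ∀ {xs} → AllPairs R xs → AllPairs (flip R) (reverse xs)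
AllPairs-reverse [] = []
AllPairs-reverse {R = R} {x ∷ xs} (Rx ∷ Rxs) =
  subst (AllPairs (flip R)) (sym (List.unfold-reverse x xs))
    (AllPairs.++⁺ (AllPairs-reverse Rxs) ([] ∷ [])
      (All.map (_∷ []) (Perm.All-resp-↭ (↭-sym (Perm.↭-reverse xs)) Rx)))

T-⇒ᵇ : ∀ {x y} → T (not x ∨ y) ⇔ (T x → T y)
T-⇒ᵇ {true}  = mk⇔ (λ t _ → t) (λ f → f _)
T-⇒ᵇ {false} = mk⇔ (λ _ ()) _

T-all : (p : A → Bool) (xs : List A) → T (all p xs) ⇔ (∀ x → x ∈ xs → T (p x))
T-all p xs = mk⇔ (λ t _ → All.lookup (All.all⁺ p xs t)) λ f → All.all⁻ p (All.tabulate (f _))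

T-pairwiseᵇ : (p : A → A → Bool) (xs : List A) →
              T (pairwiseᵇ p xs) ⇔ AllPairs (λ x y → T (p x y)) xs
T-pairwiseᵇ p xs = mk⇔ (⇒ xs) ⇐
  where
  ⇒ : ∀ xs → T (pairwiseᵇ p xs) → AllPairs (λ x y → T (p x y)) xs
  ⇒ [] _ = []
  ⇒ (x ∷ xs) t = let px , pxs = to T-∧ t in All.all⁺ (p x) xs px ∷ ⇒ xs pxs
  ⇐ : ∀ {xs} → AllPairs (λ x y → T (p x y)) xs → T (pairwiseᵇ p xs)
  ⇐ [] = _
  ⇐ (px ∷ pxs) = from T-∧ (All.all⁻ _ px , ⇐ pxs)

All-mapMaybe⇔ : (f : A → Maybe B) {P : B → Set} (xs : List A) →
                All P (mapMaybe f xs) ⇔ All (λ x → ∀ y → f x ≡ just y → P y) xs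
All-mapMaybe⇔ {A = A} f {P} xs = mk⇔ (⇒ xs) ⇐
  where
  P′ : A → Set
  P′ x = ∀ y → f x ≡ just y → P y
  ⇒ : ∀ xs → All P (mapMaybe f xs) → All P′ xs
  ⇒ [] _ = []
  ⇒ (x ∷ xs) ps with f x in fx
  ⇒ (x ∷ xs) ps       | nothing = (λ y eq → case trans (sym fx) eq of λ ()) ∷ ⇒ xs ps
  ⇒ (x ∷ xs) (p ∷ ps) | just _  = (λ y eq → case trans (sym fx) eq of λ { refl → p }) ∷ ⇒ xs ps
  ⇐ : ∀ {xs} → All P′ xs → All P (mapMaybe f xs)
  ⇐ [] = []
  ⇐ {x ∷ xs} (p ∷ ps) with f x
  ... | nothing = ⇐ ps
  ... | just y  = p y refl ∷ ⇐ ps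

-- Used for columns, where `mapMaybe` drops the rows that are too short: a condition on the entries
-- of a column becomes one on pairs of rows that both reach it.
AllPairs-mapMaybe⇔ : (f : A → Maybe B) {R : B → B → Set} (xs : List A) →
  AllPairs R (mapMaybe f xs) ⇔
  AllPairs (λ x x′ → ∀ y y′ → f x ≡ just y → f x′ ≡ just y′ → R y y′) xs
AllPairs-mapMaybe⇔ {A = A} f {R} xs = mk⇔ (⇒ xs) ⇐
  where
  R′ : A → A → Set
  R′ x x′ = ∀ y y′ → f x ≡ just y → f x′ ≡ just y′ → R y y′
  ⇒ : ∀ xs → AllPairs R (mapMaybe f xs) → AllPairs R′ xs
  ⇒ [] _ = []
  ⇒ (x ∷ xs) ps with f x in fx
  ⇒ (x ∷ xs) ps | nothing =
    All.universal (λ _ _ _ eq → case trans (sym fx) eq of λ ()) xs ∷ ⇒ xs ps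
  ⇒ (x ∷ xs) (p ∷ ps) | just _ =
    All.map (λ q y y′ eq eq′ → case trans (sym fx) eq of λ { refl → q y′ eq′ })
      (to (All-mapMaybe⇔ f xs) p) ∷ ⇒ xs ps
  ⇐ : ∀ {xs} → AllPairs R′ xs → AllPairs R (mapMaybe f xs)
  ⇐ [] = []
  ⇐ {x ∷ xs} (p ∷ ps) with f x
  ... | nothing = ⇐ ps
  ... | just y  = from (All-mapMaybe⇔ f xs) (All.map (λ q y′ → q y y′ refl) p) ∷ ⇐ ps

nth-< : ∀ (xs : List A) {n x} → nth xs n ≡ just x → n < length xs
nth-< (_ ∷ xs) {zero}  _  = z<s
nth-< (_ ∷ xs) {suc n} eq = s<s (nth-< xs eq)

<-nth : ∀ (xs : List A) {n} → n < length xs → ∃ λ x → nth xs n ≡ just x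
<-nth (x ∷ xs) {zero}  _         = x , refl
<-nth (x ∷ xs) {suc n} (s≤s n<) = <-nth xs n<

nth-All⇔ : ∀ xs → (∀ i {x} → nth xs i ≡ just x → P x) ⇔ All P xs
nth-All⇔ {P = P} xs = mk⇔ (⇒ xs) ⇐
  where
  ⇒ : ∀ xs → (∀ i {x} → nth xs i ≡ just x → P x) → All P xs
  ⇒ []       f = []
  ⇒ (x ∷ xs) f = f 0 refl ∷ ⇒ xs (f ∘ suc)
  ⇐ : ∀ {xs} → All P xs → ∀ i {x} → nth xs i ≡ just x → P x
  ⇐ (p ∷ ps) zero    refl = p
  ⇐ (p ∷ ps) (suc i) eq   = ⇐ ps i eq

nth-AllPairs⇔ : ∀ xs → (∀ i j {x y} → i < j → nth xs i ≡ just x → nth xs j ≡ just y → R x y) ⇔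
                       AllPairs R xs
nth-AllPairs⇔ {R = R} xs = mk⇔ (⇒ xs) ⇐
  where
  ⇒ : ∀ xs → (∀ i j {x y} → i < j → nth xs i ≡ just x → nth xs j ≡ just y → R x y) → AllPairs R xs
  ⇒ []       f = []
  ⇒ (x ∷ xs) f = to (nth-All⇔ xs) (λ j → f 0 (suc j) z<s refl) ∷
                 ⇒ xs (λ i j i<j → f (suc i) (suc j) (s<s i<j))
  ⇐ : ∀ {xs} → AllPairs R xs → ∀ i j {x y} → i < j → nth xs i ≡ just x → nth xs j ≡ just y → R x y
  ⇐ (p ∷ ps) zero    (suc j) _         refl eq  = from (nth-All⇔ _) p j eq
  ⇐ (p ∷ ps) (suc i) (suc j) (s≤s i<j) eq   eq′ = ⇐ ps i j i<j eq eq′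

length≤maxPart : (F : List (List A)) → All (λ t → length t ≤ maxPart (map length F)) F
length≤maxPart []      = []
length≤maxPart (t ∷ F) = ℕ.m≤m⊔n _ _ ∷
  All.map (λ le → ℕ.≤-trans le (ℕ.m≤n⊔m (length t) _)) (length≤maxPart F)

-- Hook letters, and the two kinds of tableaux in terms of `⊑` and `◁`.

module Hook (k l : ℕ) where
  open LetterOps k l

  infix 4 _⊑_
  _⊑_ : Letter k l → Letter k l → Set
  inj₁ i ⊑ inj₁ j = toℕ i ≤ toℕ j
  inj₁ i ⊑ inj₂ j = ⊤
  inj₂ i ⊑ inj₁ j = ⊥
  inj₂ i ⊑ inj₂ j = toℕ i < toℕ j

  _⊑?_ : ∀ a b → Dec (a ⊑ b)
  inj₁ i ⊑? inj₁ j = toℕ i ℕ.≤? toℕ j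
  inj₁ i ⊑? inj₂ j = yes tt
  inj₂ i ⊑? inj₁ j = no λ ()
  inj₂ i ⊑? inj₂ j = toℕ i ℕ.<? toℕ j

  ⊑-trans : ∀ {a b c} → a ⊑ b → b ⊑ c → a ⊑ c
  ⊑-trans {inj₁ i} {inj₁ j} {inj₁ m} p q = ℕ.≤-trans p q
  ⊑-trans {inj₁ i} {_}      {inj₂ m} p q = tt
  ⊑-trans {inj₂ i} {inj₂ j} {inj₂ m} p q = ℕ.<-trans p q

  ⋢-⊑-trans : ∀ {a b c} → ¬ b ⊑ a → b ⊑ c → a ⊑ c
  ⋢-⊑-trans {inj₁ i} {inj₁ j} {inj₁ m} p q = ℕ.≤-trans (ℕ.<⇒≤ (ℕ.≰⇒> p)) q
  ⋢-⊑-trans {inj₁ i} {_}      {inj₂ m} p q = tt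
  ⋢-⊑-trans {inj₂ i} {inj₁ j} {_}      p q = contradiction tt p
  ⋢-⊑-trans {inj₂ i} {inj₂ j} {inj₂ m} p q = ℕ.≤-<-trans (ℕ.≮⇒≥ p) q

  ⊑-⋢-trans : ∀ {a b c} → a ⊑ b → ¬ c ⊑ b → a ⊑ c
  ⊑-⋢-trans {inj₁ i} {inj₁ j} {inj₁ m} p q = ℕ.≤-trans p (ℕ.<⇒≤ (ℕ.≰⇒> q))
  ⊑-⋢-trans {inj₁ i} {inj₂ j} {inj₁ m} p q = contradiction tt q
  ⊑-⋢-trans {inj₁ i} {_}      {inj₂ m} p q = tt
  ⊑-⋢-trans {inj₂ i} {inj₂ j} {inj₁ m} p q = contradiction tt q
  ⊑-⋢-trans {inj₂ i} {inj₂ j} {inj₂ m} p q = ℕ.<-≤-trans p (ℕ.≮⇒≥ q)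

  open Rows _⊑_ _⊑?_ ⊑-trans ⋢-⊑-trans ⊑-⋢-trans public

  T-rowOK : ∀ a b → T (rowOK a b) ⇔ a ⊑ b
  T-rowOK (inj₁ i) (inj₁ j) = mk⇔ (λ t → ℕ.≤ᵇ⇒≤ _ _ (proj₁ (to T-∧ t)))
    λ p → let t = ℕ.≤⇒≤ᵇ p in from T-∧ (t , from T-∧ (t , _))
  T-rowOK (inj₁ i) (inj₂ j) = mk⇔ _ _
  T-rowOK (inj₂ i) (inj₁ j) = mk⇔ id id
  T-rowOK (inj₂ i) (inj₂ j) = mk⇔ (λ t → ℕ.<ᵇ⇒< _ _ (proj₂ (to (T-∧ {toℕ i ≤ᵇ toℕ j}) t)))
    λ p → from T-∧ (ℕ.≤⇒≤ᵇ (ℕ.<⇒≤ p) , ℕ.<⇒<ᵇ p)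

  -- As `firstColOK` has the same body as `colOK`, this also serves the first column of composition
  -- tableaux.
  T-colOK : ∀ a b → T (colOK a b) ⇔ (a ◁ b)
  T-colOK (inj₁ i) (inj₁ j) =
    mk⇔ (λ t → ℕ.<⇒≱ (ℕ.<ᵇ⇒< _ _ (proj₁ (to T-∧ (proj₂ (to (T-∧ {toℕ i ≤ᵇ toℕ j}) t))))))
    λ p → from T-∧ (ℕ.≤⇒≤ᵇ (ℕ.<⇒≤ (ℕ.≰⇒> p)) , from T-∧ (ℕ.<⇒<ᵇ (ℕ.≰⇒> p) , _))
  T-colOK (inj₁ i) (inj₂ j) = mk⇔ (λ _ ()) _
  T-colOK (inj₂ i) (inj₁ j) = mk⇔ (λ ()) (λ p → p tt)
  T-colOK (inj₂ i) (inj₂ j) = mk⇔ (λ t → ℕ.≤⇒≯ (ℕ.≤ᵇ⇒≤ _ _ (proj₁ (to T-∧ t))))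
    λ p → let t = ℕ.≤⇒≤ᵇ (ℕ.≮⇒≥ p) in from T-∧ (t , t)

  Path⇒All : ∀ {a b} t → a ⊑ b → Path b t → All (a ⊑_) t
  Path⇒All []      _   _         = []
  Path⇒All (c ∷ t) a⊑b (b⊑c , π) = let a⊑c = ⊑-trans a⊑b b⊑c in a⊑c ∷ Path⇒All t a⊑c π

  -- The Boolean check compares all pairs in a row, a path only neighbours; transitivity of `⊑`
  -- bridges the two.
  Path⇒AllPairs : ∀ {a} t → Path a t → AllPairs _⊑_ (a ∷ t)
  Path⇒AllPairs []      _         = [] ∷ []
  Path⇒AllPairs (b ∷ t) (a⊑b , π) = (a⊑b ∷ Path⇒All t a⊑b π) ∷ Path⇒AllPairs t π

  AllPairs⇒Path : ∀ {a} t → AllPairs _⊑_ (a ∷ t) → Path a t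
  AllPairs⇒Path []      _                    = tt
  AllPairs⇒Path (b ∷ t) ((a⊑b ∷ _) ∷ ps) = a⊑b , AllPairs⇒Path t ps

  IsRow⇒rowOK : ∀ t → IsRow t → T (pairwiseᵇ rowOK t)
  IsRow⇒rowOK (a ∷ t) π =
    from (T-pairwiseᵇ rowOK (a ∷ t)) (AllPairs.map (from (T-rowOK _ _)) (Path⇒AllPairs t π))

  rowOK⇒IsRow : ∀ t → 0 < length t → T (pairwiseᵇ rowOK t) → IsRow t
  rowOK⇒IsRow (a ∷ t) _ ok =
    AllPairs⇒Path t (AllPairs.map (to (T-rowOK _ _)) (to (T-pairwiseᵇ rowOK (a ∷ t)) ok))

  rows⇔ : ∀ {F} → All (0 <_) (map length F) → T (all (pairwiseᵇ rowOK) F) ⇔ All IsRow F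
  rows⇔ {F} F+ = mk⇔
    (λ t → All.zipWith (λ {t} → uncurry (rowOK⇒IsRow t))
             (All.map⁻ F+ , All.all⁺ (pairwiseᵇ rowOK) F t))
    (All.all⁻ _ ∘ All.map (λ {t} → IsRow⇒rowOK t))

  ColumnPair : ℕ → List (Letter k l) → List (Letter k l) → Set
  ColumnPair j s u = ∀ a b → nth s j ≡ just a → nth u j ≡ just b → a ◁ b

  T-column : ∀ F j → T (pairwiseᵇ colOK (column F j)) ⇔ AllPairs (ColumnPair j) F
  T-column F j = mk⇔
    (λ t → to (AllPairs-mapMaybe⇔ (λ row → nth row j) F)
             (AllPairs.map (to (T-colOK _ _)) (to (T-pairwiseᵇ colOK _) t)))
    (λ ps → from (T-pairwiseᵇ colOK _) (AllPairs.map (from (T-colOK _ _))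
             (from (AllPairs-mapMaybe⇔ (λ row → nth row j) F) ps)))

  -- The length half comes from the partition shape when a filling is checked, and yields the
  -- partition shape when a sorted tableau is given.
  ◁*⇔ : ∀ s u → s ◁* u ⇔ (length u ≤ length s × ∀ j → ColumnPair j s u)
  ◁*⇔ s u = mk⇔ (λ p → lengths s u p , pairs s u p) (uncurry (⇐ s u))
    where
    lengths : ∀ s u → s ◁* u → length u ≤ length s
    lengths s       []      _        = z≤n
    lengths (a ∷ s) (b ∷ u) (_ , su) = s≤s (lengths s u su)
    pairs : ∀ s u → s ◁* u → ∀ j → ColumnPair j s u
    pairs (a ∷ s) (b ∷ u) (ab , _)  zero    _ _ refl refl = ab
    pairs (a ∷ s) (b ∷ u) (_  , su) (suc j) = pairs s u su j
    ⇐ : ∀ s u → length u ≤ length s → (∀ j → ColumnPair j s u) → s ◁* u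
    ⇐ s       []      _        _ = tt
    ⇐ (a ∷ s) (b ∷ u) (s≤s le) f = f 0 a b refl refl , ⇐ s u le (f ∘ suc)

  isSSHT⇔ : ∀ {F} → IsPartition (map length F) → T (isSSHT F) ⇔ IsTableau F
  isSSHT⇔ {F} (F+ , F↘) = mk⇔
    (λ t → let rs , cs = to (T-∧ {all (pairwiseᵇ rowOK) F}) t in
      to (rows⇔ F+) rs ,
      AllPairs.zipWith (λ (le , f) → from (◁*⇔ _ _) (le , f)) (lengths , columns cs))
    (λ (rs , cs) → from T-∧ (from (rows⇔ F+) rs , from (T-all _ (upTo m)) λ j _ →
      from (T-column F j) (AllPairs.map (λ {s} {u} su → proj₂ (to (◁*⇔ s u) su) j) cs)))
    where
    m = maxPart (map length F)
    lengths : AllPairs (λ s u → length u ≤ length s) F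
    lengths = AllPairs.map⁻ (Linked.Linked⇒AllPairs (flip ℕ.≤-trans) F↘)
    columns : T (all (λ j → pairwiseᵇ colOK (column F j)) (upTo m)) →
              AllPairs (λ s u → ∀ j → ColumnPair j s u) F
    -- Only columns below `m` are checked, but an entry in column `j` of `s` forces
    -- `j < length s ≤ m`.
    columns cs = to (nth-AllPairs⇔ F) λ i i′ {s} i<i′ is iu j a b ja jb →
      from (nth-AllPairs⇔ F)
        (to (T-column F j) (to (T-all _ (upTo m)) cs _
          (∈-upTo⁺ (ℕ.<-≤-trans (nth-< s ja) (from (nth-All⇔ F) (length≤maxPart F) i is)))))
        i i′ i<i′ is iu a b ja jb

  -- The entries are F̂(i,n+1), F̂(j,n) and F̂(j,n+1), in this order.
  tripleᵇ : Maybe (Letter k l) → Maybe (Letter k l) → Maybe (Letter k l) → Bool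
  tripleᵇ nothing         p b = true
  tripleᵇ (just (inj₁ e)) p b = (p ≤E just (inj₁ e)) ⇒ᵇ (b <E just (inj₁ e))
  tripleᵇ (just (inj₂ e)) p b = (p <E just (inj₂ e)) ⇒ᵇ (b ≤E just (inj₂ e))

  tripleOK≡ : ∀ F i j n →
             tripleOK F i j n ≡ tripleᵇ (entry F i (suc n)) (entry F j n) (entry F j (suc n))
  tripleOK≡ F i j n with entry F i (suc n)
  ... | nothing       = refl
  ... | just (inj₁ _) = refl
  ... | just (inj₂ _) = refl

  ≤ᵇ⇔ : ∀ {m n} → T (m ≤ᵇ n) ⇔ m ≤ n
  ≤ᵇ⇔ = mk⇔ (ℕ.≤ᵇ⇒≤ _ _) ℕ.≤⇒≤ᵇ

  <ᵇ⇔ : ∀ {m n} → T (m <ᵇ n) ⇔ m < n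
  <ᵇ⇔ = mk⇔ (ℕ.<ᵇ⇒< _ _) ℕ.<⇒<ᵇ

  -- The unprimed and primed clauses of the triple rule differ in which inequality is strict. This
  -- and the next three equivalences give both clauses the premise `p ⊑ e` and the conclusion
  -- `b ◁ e`.
  ≤L⇔ : ∀ p e → T (p ≤L inj₁ e) ⇔ p ⊑ inj₁ e
  ≤L⇔ (inj₁ _) e = ≤ᵇ⇔
  ≤L⇔ (inj₂ _) e = mk⇔ id id

  <L⇔ : ∀ p e → T (p <L inj₂ e) ⇔ p ⊑ inj₂ e
  <L⇔ (inj₁ _) e = mk⇔ _ _
  <L⇔ (inj₂ _) e = <ᵇ⇔

  <L⇔◁ : ∀ b e → T (b <L inj₁ e) ⇔ (b ◁ inj₁ e)
  <L⇔◁ (inj₁ _) e = mk⇔ (ℕ.<⇒≱ ∘ to <ᵇ⇔) (from <ᵇ⇔ ∘ ℕ.≰⇒>)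
  <L⇔◁ (inj₂ _) e = mk⇔ (λ ()) (λ f → f tt)

  ≤L⇔◁ : ∀ b e → T (b ≤L inj₂ e) ⇔ (b ◁ inj₂ e)
  ≤L⇔◁ (inj₁ _) e = mk⇔ (λ _ ()) _
  ≤L⇔◁ (inj₂ _) e = mk⇔ (ℕ.≤⇒≯ ∘ to ≤ᵇ⇔) (from ≤ᵇ⇔ ∘ ℕ.≮⇒≥)

  -- An ∞ in place of `e` or `p` leaves nothing to check, whereas an ∞ in place of `b` violates the
  -- conclusion; hence the existential.
  TripleRule : Maybe (Letter k l) → Maybe (Letter k l) → Maybe (Letter k l) → Set
  TripleRule me mp mb =
    ∀ e p → me ≡ just e → mp ≡ just p → p ⊑ e → ∃ λ b → mb ≡ just b × b ◁ e

  T-tripleᵇ : ∀ me mp mb → T (tripleᵇ me mp mb) ⇔ TripleRule me mp mb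
  T-tripleᵇ nothing mp mb = mk⇔ (λ _ _ _ ()) _
  T-tripleᵇ (just (inj₁ e)) nothing mb = mk⇔ (λ _ _ _ _ ()) _
  T-tripleᵇ (just (inj₂ e)) nothing mb = mk⇔ (λ _ _ _ _ ()) _
  T-tripleᵇ (just (inj₁ e)) (just p) nothing = mk⇔
    (λ { t _ _ refl refl p⊑e → ⊥-elim (to T-⇒ᵇ t (from (≤L⇔ p e) p⊑e)) })
    (λ f → from T-⇒ᵇ λ t → case f _ _ refl refl (to (≤L⇔ p e) t) of λ ())
  T-tripleᵇ (just (inj₁ e)) (just p) (just b) = mk⇔
    (λ { t _ _ refl refl p⊑e → b , refl , to (<L⇔◁ b e) (to T-⇒ᵇ t (from (≤L⇔ p e) p⊑e)) })
    (λ f → from T-⇒ᵇ λ t → case f _ _ refl refl (to (≤L⇔ p e) t) of λ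
      { (_ , refl , b◁e) → from (<L⇔◁ b e) b◁e })
  T-tripleᵇ (just (inj₂ e)) (just p) nothing = mk⇔
    (λ { t _ _ refl refl p⊑e → ⊥-elim (to T-⇒ᵇ t (from (<L⇔ p e) p⊑e)) })
    (λ f → from T-⇒ᵇ λ t → case f _ _ refl refl (to (<L⇔ p e) t) of λ ())
  T-tripleᵇ (just (inj₂ e)) (just p) (just b) = mk⇔
    (λ { t _ _ refl refl p⊑e → b , refl , to (≤L⇔◁ b e) (to T-⇒ᵇ t (from (<L⇔ p e) p⊑e)) })
    (λ f → from T-⇒ᵇ λ t → case f _ _ refl refl (to (<L⇔ p e) t) of λ
      { (_ , refl , b◁e) → from (≤L⇔◁ b e) b◁e })

  entry≡nth : ∀ (F : Filling k l) i j {t} → nth F i ≡ just t → entry F i j ≡ nth t j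
  entry≡nth F i j eq rewrite eq = refl

  TriplePair : ℕ → List (Letter k l) → List (Letter k l) → Set
  TriplePair n t w = TripleRule (nth t (suc n)) (nth w n) (nth w (suc n))

  T-tripleOK : ∀ F i j n {t w} → nth F i ≡ just t → nth F j ≡ just w →
               T (tripleOK F i j n) ⇔ TriplePair n t w
  T-tripleOK F i j n {t} {w} it jw
    rewrite tripleOK≡ F i j n | entry≡nth F i (suc n) it
          | entry≡nth F j n jw | entry≡nth F j (suc n) jw =
    T-tripleᵇ (nth t (suc n)) (nth w n) (nth w (suc n))

  -- Prepending `p` shifts indices by one: position `n` of `p ∷ w` is the left neighbour of position
  -- `n` of `w`.
  TripleFrom⇔ : ∀ p t w →
    TripleFrom p t w ⇔ (∀ n → TripleRule (nth t n) (nth (p ∷ w) n) (nth w n))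
  TripleFrom⇔ p t w = mk⇔ (⇒ p t w) (⇐ p t w)
    where
    ⇒ : ∀ p t w → TripleFrom p t w → ∀ n → TripleRule (nth t n) (nth (p ∷ w) n) (nth w n)
    ⇒ p (e ∷ t) []      τ       zero    _ _ refl refl p⊑e = contradiction p⊑e τ
    ⇒ p (e ∷ t) []      τ       (suc n) _ _ _    ()
    ⇒ p (e ∷ t) (b ∷ w) (τ , _) zero    _ _ refl refl p⊑e = b , refl , τ p⊑e
    ⇒ p (e ∷ t) (b ∷ w) (_ , τ) (suc n) = ⇒ b t w τ n
    ⇐ : ∀ p t w → (∀ n → TripleRule (nth t n) (nth (p ∷ w) n) (nth w n)) → TripleFrom p t w
    ⇐ p []      w       f = tt
    ⇐ p (e ∷ t) []      f p⊑e with f 0 e p refl refl p⊑e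
    ... | _ , () , _
    ⇐ p (e ∷ t) (b ∷ w) f = head , ⇐ b t w (f ∘ suc)
      where
      head : p ⊑ e → b ◁ e
      head p⊑e with f 0 e p refl refl p⊑e
      ... | _ , refl , b◁e = b◁e

  Triple⇔ : ∀ {t w} → IsRow t → IsRow w → Triple t w ⇔ (ColumnPair 0 t w × ∀ n → TriplePair n t w)
  Triple⇔ {a ∷ t} {b ∷ w} _ _ = mk⇔
    (λ (a◁b , τ) → (λ { _ _ refl refl → a◁b }) , to (TripleFrom⇔ b t w) τ)
    (λ (a◁b , τ) → a◁b _ _ refl refl , from (TripleFrom⇔ b t w) τ)

  -- A filling lists its bottom row first and `IsComposition` its top row first, hence the reversal.
  isHCT⇔ : ∀ {F} → All (0 <_) (map length F) → T (isHCT F) ⇔ IsComposition (reverse F)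
  isHCT⇔ {F} F+ = mk⇔
    (λ t → let rs , t′ = to (T-∧ {all (pairwiseᵇ rowOK) F}) t
               cs , ts = to (T-∧ {pairwiseᵇ firstColOK (column F 0)}) t′
               rows = to (rows⇔ F+) rs
           in Perm.All-resp-↭ (↭-sym (Perm.↭-reverse F)) rows
            , AllPairs-reverse (to (nth-AllPairs⇔ F) λ i j i<j it jw →
                from (Triple⇔ (from (nth-All⇔ F) rows i it) (from (nth-All⇔ F) rows j jw))
                  (from (nth-AllPairs⇔ F) (to (T-column F 0) cs) i j i<j it jw
                  , triple ts i j i<j it jw)))
    (λ (rs , ts) →
      let rows = Perm.All-resp-↭ (Perm.↭-reverse F) rs
          triples = from (nth-AllPairs⇔ F)
            (subst (AllPairs Triple) (List.reverse-involutive F) (AllPairs-reverse ts))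
          both = λ i j {t} {w} (i<j : i < j) (it : nth F i ≡ just t) (jw : nth F j ≡ just w) →
            to (Triple⇔ (from (nth-All⇔ F) rows i it) (from (nth-All⇔ F) rows j jw))
              (triples i j i<j it jw)
      in from T-∧ (from (rows⇔ F+) rows , from T-∧
        ( from (T-column F 0) (to (nth-AllPairs⇔ F) λ i j i<j it jw → proj₁ (both i j i<j it jw))
        , from (T-all _ (upTo r)) λ i i∈ → from (T-all _ (filterᵇ (i <ᵇ_) (upTo r))) λ j j∈ →
            from (T-all _ (upTo (m ∸ 1))) λ n _ →
              let j∈′ , i<ᵇj = to (∈-filterᵇ⇔ (i <ᵇ_) (upTo r)) j∈
                  t , it = <-nth F (∈-upTo⁻ i∈)
                  w , jw = <-nth F (∈-upTo⁻ j∈′)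
              in from (T-tripleOK F i j n it jw) (proj₂ (both i j (to <ᵇ⇔ i<ᵇj) it jw) n))))
    where
    r = length F
    m = maxPart (map length F)
    triple : T (all (λ i → all (λ j → all (λ n → tripleOK F i j n) (upTo (m ∸ 1)))
                               (filterᵇ (i <ᵇ_) (upTo r))) (upTo r)) →
             ∀ i j {t w} → i < j → nth F i ≡ just t → nth F j ≡ just w → ∀ n → TriplePair n t w
    triple ts i j {t} i<j it jw n e p te = to (T-tripleOK F i j n it jw)
      (to (T-all _ (upTo (m ∸ 1)))
        (to (T-all _ (filterᵇ (i <ᵇ_) (upTo r)))
          (to (T-all _ (upTo r)) ts _ (∈-upTo⁺ (nth-< F it)))
          _
          (from (∈-filterᵇ⇔ (i <ᵇ_) (upTo r)) (∈-upTo⁺ (nth-< F jw) , from <ᵇ⇔ i<j)))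
        _
        -- The entry `e` sits in column `suc n`, so `suc n < length t ≤ m` and `n` is below `m ∸ 1`.
        (∈-upTo⁺ (ℕ.∸-monoˡ-≤ 1 (ℕ.≤-trans (nth-< t te)
          (from (nth-All⇔ F) (length≤maxPart F) i it)))))
      e p te

-- The weight-preserving bijection between the two enumerations.

theorem3p1 : (k l : ℕ) (la : List ℕ) → IsPartition la →
    HS k l la ↭ concatMap (HQ k l) (compositionsOf la)
theorem3p1 k l la part@(la+ , la↘) = begin
  map weight tableaux
    ↭⟨ Perm.map⁺ weight (↭-map-bijection g tableaux! compositionTableaux! into inj onto) ⟩
  map weight (map g compositionTableaux)
    ≡⟨ sym (List.map-∘ compositionTableaux) ⟩
  map (weight ∘ g) compositionTableaux
    ≡⟨ List.map-cong (λ F → weight-↭ (g F) F (g-concat F)) compositionTableaux ⟩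
  map weight compositionTableaux
    ≡⟨ List.map-concatMap weight HCT (compositionsOf la) ⟩
  concatMap (HQ k l) (compositionsOf la) ∎
  where
  open PermutationReasoning
  open Hook k l
  HCT : List ℕ → List (Filling k l)
  HCT α = filterᵇ isHCT (fillings k l α)
  tableaux compositionTableaux : List (Filling k l)
  tableaux = filterᵇ isSSHT (fillings k l la)
  compositionTableaux = concatMap HCT (compositionsOf la)
  g : Filling k l → Filling k l
  g F = sortColumns (reverse F)
  g-concat : ∀ F → concat (g F) ↭ concat F
  g-concat F = ↭-trans (sortColumns-concat-↭ (reverse F)) (concat-↭ (Perm.↭-reverse F))
  lengths-reverse : ∀ F → map length (reverse F) ↭ map length F
  lengths-reverse F = Perm.map⁺ length (Perm.↭-reverse F)
  tableaux! : Unique tableaux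
  tableaux! = filterᵇ-unique isSSHT (fillings-unique k l la)
  ∈-HCT : ∀ {α F} → F ∈ HCT α ⇔ (map length F ≡ α × T (isHCT F))
  ∈-HCT {α} = mk⇔
    (λ F∈ → let F∈′ , t = to (∈-filterᵇ⇔ isHCT (fillings k l α)) F∈ in to (∈-fillings⇔ α) F∈′ , t)
    (λ (eq , t) → from (∈-filterᵇ⇔ isHCT (fillings k l α)) (from (∈-fillings⇔ α) eq , t))
  compositionTableaux! : Unique compositionTableaux
  compositionTableaux! = concatMap-unique HCT (λ α → filterᵇ-unique isHCT (fillings-unique k l α))
    -- Different shapes give disjoint lists, because a filling determines its row lengths.
    (λ p q → trans (sym (proj₁ (to ∈-HCT p))) (proj₁ (to ∈-HCT q))) (compositionsOf-unique la)
  ∈-compositionTableaux⇔ : ∀ {F} →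
    F ∈ compositionTableaux ⇔ (map length F ↭ la × IsComposition (reverse F))
  ∈-compositionTableaux⇔ = mk⇔
    (λ F∈ → let α , α∈ , F∈′ = to (∈-concatMap⇔ HCT (compositionsOf la)) F∈
                eq , t = to ∈-HCT F∈′
                shape = subst (_↭ la) (sym eq) (to (∈-compositionsOf⇔ part) α∈)
            in shape , to (isHCT⇔ (Perm.All-resp-↭ (↭-sym shape) la+)) t)
    (λ (shape , c) → from (∈-concatMap⇔ HCT (compositionsOf la))
      (_ , from (∈-compositionsOf⇔ part) shape
         , from ∈-HCT (refl , from (isHCT⇔ (Perm.All-resp-↭ (↭-sym shape) la+)) c)))
  ∈-tableaux⇔ : ∀ {F} → F ∈ tableaux ⇔ (map length F ≡ la × IsTableau F)
  ∈-tableaux⇔ = mk⇔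
    (λ F∈ → let F∈′ , t = to (∈-filterᵇ⇔ isSSHT (fillings k l la)) F∈
                eq = to (∈-fillings⇔ la) F∈′
            in eq , to (isSSHT⇔ (subst IsPartition (sym eq) part)) t)
    (λ (eq , tab) → from (∈-filterᵇ⇔ isSSHT (fillings k l la))
      (from (∈-fillings⇔ la) eq , from (isSSHT⇔ (subst IsPartition (sym eq) part)) tab))
  shape-sorted : ∀ {T} → IsTableau T → map length T ↭ la → map length T ≡ la
  -- Both `map length T` and `la` are decreasing rearrangements of `map length T`, so both equal
  -- `sortDec (map length T)`.
  shape-sorted (_ , cs) T↭la = trans
    (sym (sortDec-unique (Linked.AllPairs⇒Linked
      (AllPairs.map⁺ (AllPairs.map (λ {s} {u} su → proj₁ (to (◁*⇔ s u) su)) cs))) ↭-refl))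
    (sortDec-unique la↘ T↭la)
  into : ∀ {F} → F ∈ compositionTableaux → g F ∈ tableaux
  into {F} F∈ =
    let shape , c = to ∈-compositionTableaux⇔ F∈
        tab = sortColumns-tableau (reverse F) c
    in from ∈-tableaux⇔ (shape-sorted tab
         (↭-trans (sortColumns-lengths-↭ (reverse F)) (↭-trans (lengths-reverse F) shape)) , tab)
  inj : ∀ {F G} → F ∈ compositionTableaux → G ∈ compositionTableaux → g F ≡ g G → F ≡ G
  inj F∈ G∈ eq = List.reverse-injective (sortColumns-injective
    (proj₂ (to ∈-compositionTableaux⇔ F∈)) (proj₂ (to ∈-compositionTableaux⇔ G∈)) eq)
  onto : ∀ {T} → T ∈ tableaux → ∃ λ F → F ∈ compositionTableaux × g F ≡ T
  onto T∈ =
    let eq , tab = to ∈-tableaux⇔ T∈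
        F , c , gF≡T = sortColumns-surjective _ tab
        F≡ = List.reverse-involutive F
    -- The preimage `F` lists rows from the top down; reversing it gives a filling, and `g` reverses
    -- it back.
    in reverse F
     , from ∈-compositionTableaux⇔
         ( ↭-trans (lengths-reverse F) (↭-trans (↭-sym (sortColumns-lengths-↭ F))
             (↭-reflexive (trans (cong (map length) gF≡T) eq)))
         , subst IsComposition (sym F≡) c)
     , trans (cong sortColumns F≡) gF≡T
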